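{- Let $G$ be a $k$-regular (finite simple) graph of order $n$ and let $\bar{G}$ be its complement. Then $$SO(K_n) = \left(\sqrt{SO(G)} + \sqrt{SO(\bar{G})}\right)^2,$$ where $K_n$ is the complete graph on $n$ vertices.
   Context: For a finite simple graph $G$, the Sombor index is $SO(G)=\sum_{uv\in E(G)}\sqrt{d_u^2+d_v^2}$, the sum being over (unordered) edges, where $d_x$ is the degree of the vertex $x$. The order of a graph is its number of vertices. -}

module Defs where

open import Data.Fin.Base using (Fin)
import Data.Fin.Properties as Fin
open import Data.Integer.Base as ℤ using (+_)
import Data.Integer.Properties as ℤ
open import Data.List.Base using (List; allFin; cartesianProduct; filter; foldr; length; map)
open import Data.Nat.Base as ℕ using (ℕ; zero; suc)
import Data.Nat.Properties as ℕ
open import Data.Product.Base using (∃-syntax; _×_; _,_; proj₁; proj₂)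
open import Data.Rational.Base as ℚ using (ℚ; 0ℚ; 1ℚ; ½; ∣_∣; ↥_; ↧ₙ_)
import Data.Rational.Properties as ℚ
open import Data.Rational.Solver using () renaming (module +-*-Solver to ℚ-Solver)
import Data.Rational.Unnormalised.Base as ℚᵘ
import Data.Rational.Unnormalised.Properties as ℚᵘ
open import Data.Sum.Base using (inj₁; inj₂)
open import Level using (0ℓ)
open import Relation.Binary.Core using (Rel)
open import Relation.Binary.Definitions using (Decidable; Irreflexive; Symmetric)
open import Relation.Binary.PropositionalEquality
  using (_≡_; _≢_; ≢-sym; refl; sym; trans; cong; cong₂;
         subst; subst₂; module ≡-Reasoning)
open import Relation.Nullary using (¬_; ¬?; _×-dec_; yes; no; contradiction)

half-pos : ∀ {ε} → 0ℚ ℚ.< ε → 0ℚ ℚ.< ½ ℚ.* ε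
half-pos {ε} 0<ε = subst (ℚ._< ½ ℚ.* ε) (ℚ.*-zeroʳ ½) (ℚ.*-monoʳ-<-pos ½ 0<ε)

halves : ∀ ε → ½ ℚ.* ε ℚ.+ ½ ℚ.* ε ≡ ε
halves ε = trans (sym (ℚ.*-distribʳ-+ ε ½ ½)) (ℚ.*-identityˡ ε)

p≤∣p∣ : ∀ p → p ℚ.≤ ∣ p ∣
p≤∣p∣ p with ℚ.≤-total 0ℚ p
... | inj₁ 0≤p = ℚ.≤-reflexive (sym (ℚ.0≤p⇒∣p∣≡p 0≤p))
... | inj₂ p≤0 = ℚ.≤-trans p≤0 (ℚ.0≤∣p∣ p)

neg-swap : ∀ p q → p ℚ.- q ≡ ℚ.- (q ℚ.- p)
neg-swap = solve 2 (λ p q → p :- q := :- (q :- p)) refl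
  where open ℚ-Solver

∣p∣<q : ∀ {p q} → p ℚ.< q → ℚ.- p ℚ.< q → ∣ p ∣ ℚ.< q
∣p∣<q {p} {q} p<q -p<q with ℚ.∣p∣≡p∨∣p∣≡-p p
... | inj₁ eq = subst (ℚ._< q) (sym eq) p<q
... | inj₂ eq = subst (ℚ._< q) (sym eq) -p<q

p≤q+∣p-q∣ : ∀ p q → p ℚ.≤ q ℚ.+ ∣ p ℚ.- q ∣
p≤q+∣p-q∣ p q = subst (ℚ._≤ q ℚ.+ ∣ p ℚ.- q ∣) lem (ℚ.+-monoʳ-≤ q (p≤∣p∣ (p ℚ.- q)))
  where
  open ℚ-Solver
  lem : q ℚ.+ (p ℚ.- q) ≡ p
  lem = solve 2 (λ p q → q :+ (p :- q) := p) refl p q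

*-mono-≤ : ∀ {p q r s} → 0ℚ ℚ.≤ r → 0ℚ ℚ.≤ q → p ℚ.≤ q → r ℚ.≤ s → p ℚ.* r ℚ.≤ q ℚ.* s
*-mono-≤ {p} {q} {r} {s} 0≤r 0≤q p≤q r≤s = ℚ.≤-trans
  (ℚ.*-monoʳ-≤-nonNeg r {{ℚ.nonNegative 0≤r}} p≤q)
  (ℚ.*-monoˡ-≤-nonNeg q {{ℚ.nonNegative 0≤q}} r≤s)

*-nonNeg : ∀ {p q} → 0ℚ ℚ.≤ p → 0ℚ ℚ.≤ q → 0ℚ ℚ.≤ p ℚ.* q
*-nonNeg {p} {q} 0≤p 0≤q = subst (ℚ._≤ p ℚ.* q) (ℚ.*-zeroʳ p)
  (ℚ.*-monoˡ-≤-nonNeg p {{ℚ.nonNegative 0≤p}} 0≤q)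

+-nonNeg : ∀ {p q} → 0ℚ ℚ.≤ p → 0ℚ ℚ.≤ q → 0ℚ ℚ.≤ p ℚ.+ q
+-nonNeg 0≤p 0≤q = ℚ.+-mono-≤ 0≤p 0≤q

quotient : ∀ {p q} → 0ℚ ℚ.< p → 0ℚ ℚ.< q → ∃[ d ] 0ℚ ℚ.< d × d ℚ.* p ≡ q
quotient {p} {q} 0<p 0<q = q ℚ.* ℚ.1/ p
  , ℚ.positive⁻¹ (q ℚ.* ℚ.1/ p)
      {{ℚ.pos*pos⇒pos q {{ℚ.positive 0<q}} (ℚ.1/ p) {{ℚ.1/pos⇒pos p}}}}
  , trans (ℚ.*-assoc q (ℚ.1/ p) p)
      (trans (cong (q ℚ.*_) (ℚ.*-inverseˡ p)) (ℚ.*-identityʳ q))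
  where
  instance
    p-pos : ℚ.Positive p
    p-pos = ℚ.positive 0<p
    p-nonZero : ℚ.NonZero p
    p-nonZero = ℚ.pos⇒nonZero p

product-close : ∀ a b c d {A D η δ} → 0ℚ ℚ.< A → 0ℚ ℚ.< D →
  ∣ a ∣ ℚ.≤ A → ∣ d ∣ ℚ.≤ D → ∣ a ℚ.- c ∣ ℚ.< η → ∣ b ℚ.- d ∣ ℚ.< δ →
  ∣ a ℚ.* b ℚ.- c ℚ.* d ∣ ℚ.< δ ℚ.* A ℚ.+ η ℚ.* D
product-close a b c d {A} {D} {η} {δ} 0<A 0<D ∣a∣≤A ∣d∣≤D ∣a-c∣<η ∣b-d∣<δ = begin-strict
  ∣ a ℚ.* b ℚ.- c ℚ.* d ∣
    ≡⟨ cong ∣_∣ (regroup a b c d) ⟩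
  ∣ (b ℚ.- d) ℚ.* a ℚ.+ (a ℚ.- c) ℚ.* d ∣
    ≤⟨ ℚ.∣p+q∣≤∣p∣+∣q∣ ((b ℚ.- d) ℚ.* a) ((a ℚ.- c) ℚ.* d) ⟩
  ∣ (b ℚ.- d) ℚ.* a ∣ ℚ.+ ∣ (a ℚ.- c) ℚ.* d ∣
    ≡⟨ cong₂ ℚ._+_ (ℚ.∣p*q∣≡∣p∣*∣q∣ (b ℚ.- d) a) (ℚ.∣p*q∣≡∣p∣*∣q∣ (a ℚ.- c) d) ⟩
  ∣ b ℚ.- d ∣ ℚ.* ∣ a ∣ ℚ.+ ∣ a ℚ.- c ∣ ℚ.* ∣ d ∣
    ≤⟨ ℚ.+-mono-≤
         (*-mono-≤ (ℚ.0≤∣p∣ a) (ℚ.0≤∣p∣ (b ℚ.- d)) ℚ.≤-refl ∣a∣≤A)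
         (*-mono-≤ (ℚ.0≤∣p∣ d) (ℚ.0≤∣p∣ (a ℚ.- c)) ℚ.≤-refl ∣d∣≤D) ⟩
  ∣ b ℚ.- d ∣ ℚ.* A ℚ.+ ∣ a ℚ.- c ∣ ℚ.* D
    <⟨ ℚ.+-mono-<
         (ℚ.*-monoˡ-<-pos A {{ℚ.positive 0<A}} ∣b-d∣<δ)
         (ℚ.*-monoˡ-<-pos D {{ℚ.positive 0<D}} ∣a-c∣<η) ⟩
  δ ℚ.* A ℚ.+ η ℚ.* D ∎
  where
  open ℚ.≤-Reasoning
  open ℚ-Solver
  regroup : ∀ a b c d → a ℚ.* b ℚ.- c ℚ.* d ≡ (b ℚ.- d) ℚ.* a ℚ.+ (a ℚ.- c) ℚ.* d
  regroup = solve 4 (λ a b c d → a :* b :- c :* d := (b :- d) :* a :+ (a :- c) :* d) refl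

*-pos : ∀ {p q} → 0ℚ ℚ.< p → 0ℚ ℚ.< q → 0ℚ ℚ.< p ℚ.* q
*-pos {p} {q} 0<p 0<q = ℚ.positive⁻¹ (p ℚ.* q)
  {{ℚ.pos*pos⇒pos p {{ℚ.positive 0<p}} q {{ℚ.positive 0<q}}}}

1/suc-nonNeg : ∀ n → 0ℚ ℚ.≤ + 1 ℚ./ suc n
1/suc-nonNeg n = ℚ.nonNegative⁻¹ (+ 1 ℚ./ suc n) {{ℚ.normalize-nonNeg 1 (suc n)}}

⊔0-nonexpansive : ∀ p q → p ℚ.⊔ 0ℚ ℚ.≤ q ℚ.⊔ 0ℚ ℚ.+ ∣ p ℚ.- q ∣
⊔0-nonexpansive p q = ℚ.⊔-lub
  (ℚ.≤-trans (p≤q+∣p-q∣ p q) (ℚ.+-monoˡ-≤ ∣ p ℚ.- q ∣ (ℚ.p≤p⊔q q 0ℚ)))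
  (+-nonNeg (ℚ.p≤q⊔p q 0ℚ) (ℚ.0≤∣p∣ (p ℚ.- q)))

-- If r ≥ s + 2h then p ≥ (s + 2h)² ≥ (s + h)² + h² > q + d, a contradiction.
root-close : ∀ {p q r s d δ h ε} → 0ℚ ℚ.≤ h → h ℚ.+ h ≡ ε →
  0ℚ ℚ.≤ r → 0ℚ ℚ.≤ s → 0ℚ ℚ.≤ δ →
  r ℚ.* r ℚ.≤ p → q ℚ.< (s ℚ.+ δ) ℚ.* (s ℚ.+ δ) →
  p ℚ.≤ q ℚ.+ d → d ℚ.< h ℚ.* h → δ ℚ.≤ h → r ℚ.- s ℚ.< ε
root-close {p} {q} {r} {s} {d} {δ} {h} {ε} 0≤h 2h≡ε 0≤r 0≤s 0≤δ r²≤p q<[s+δ]² p≤q+d d<h² δ≤h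
  with r ℚ.- s ℚ.<? ε
... | yes lt = lt
... | no ¬lt = contradiction refl (ℚ.<⇒≢ (begin-strict
  p
    ≤⟨ p≤q+d ⟩
  q ℚ.+ d
    <⟨ ℚ.+-mono-< q<[s+δ]² d<h² ⟩
  (s ℚ.+ δ) ℚ.* (s ℚ.+ δ) ℚ.+ h ℚ.* h
    ≤⟨ ℚ.+-monoˡ-≤ (h ℚ.* h) (*-mono-≤ (+-nonNeg 0≤s 0≤δ) 0≤s+h s+δ≤s+h s+δ≤s+h) ⟩
  (s ℚ.+ h) ℚ.* (s ℚ.+ h) ℚ.+ h ℚ.* h
    ≡⟨ ℚ.+-identityʳ ((s ℚ.+ h) ℚ.* (s ℚ.+ h) ℚ.+ h ℚ.* h) ⟨
  ((s ℚ.+ h) ℚ.* (s ℚ.+ h) ℚ.+ h ℚ.* h) ℚ.+ 0ℚ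
    ≤⟨ ℚ.+-monoʳ-≤ ((s ℚ.+ h) ℚ.* (s ℚ.+ h) ℚ.+ h ℚ.* h)
         (+-nonNeg (*-nonNeg 0≤s+h 0≤h) (*-nonNeg 0≤s+h 0≤h)) ⟩
  ((s ℚ.+ h) ℚ.* (s ℚ.+ h) ℚ.+ h ℚ.* h) ℚ.+ ((s ℚ.+ h) ℚ.* h ℚ.+ (s ℚ.+ h) ℚ.* h)
    ≡⟨ expand s h ⟨
  (s ℚ.+ (h ℚ.+ h)) ℚ.* (s ℚ.+ (h ℚ.+ h))
    ≤⟨ *-mono-≤ (+-nonNeg 0≤s (+-nonNeg 0≤h 0≤h)) 0≤r s+2h≤r s+2h≤r ⟩
  r ℚ.* r
    ≤⟨ r²≤p ⟩
  p ∎))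
  where
  open ℚ.≤-Reasoning
  open ℚ-Solver
  0≤s+h = +-nonNeg 0≤s 0≤h

  s+δ≤s+h : s ℚ.+ δ ℚ.≤ s ℚ.+ h
  s+δ≤s+h = ℚ.+-monoʳ-≤ s δ≤h

  cancel : ∀ a b → b ℚ.+ (a ℚ.- b) ≡ a
  cancel = solve 2 (λ a b → b :+ (a :- b) := a) refl

  s+2h≤r : s ℚ.+ (h ℚ.+ h) ℚ.≤ r
  s+2h≤r = begin
    s ℚ.+ (h ℚ.+ h)  ≡⟨ cong (s ℚ.+_) 2h≡ε ⟩
    s ℚ.+ ε          ≤⟨ ℚ.+-monoʳ-≤ s (ℚ.≮⇒≥ ¬lt) ⟩
    s ℚ.+ (r ℚ.- s)  ≡⟨ cancel r s ⟩
    r                ∎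

  expand : ∀ a b → (a ℚ.+ (b ℚ.+ b)) ℚ.* (a ℚ.+ (b ℚ.+ b))
    ≡ ((a ℚ.+ b) ℚ.* (a ℚ.+ b) ℚ.+ b ℚ.* b) ℚ.+ ((a ℚ.+ b) ℚ.* b ℚ.+ (a ℚ.+ b) ℚ.* b)
  expand = solve 2 (λ a b → (a :+ (b :+ b)) :* (a :+ (b :+ b))
    := ((a :+ b) :* (a :+ b) :+ b :* b) :+ ((a :+ b) :* b :+ (a :+ b) :* b)) refl

fromℕℚ : ℕ → ℚ
fromℕℚ n = + n ℚ./ 1

/-*-cancel : ∀ m d .{{_ : ℕ.NonZero d}} → (+ m ℚ./ d) ℚ.* fromℕℚ d ≡ fromℕℚ m
/-*-cancel m (suc d) = ℚ.toℚᵘ-injective (begin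
  ℚ.toℚᵘ ((+ m ℚ./ suc d) ℚ.* fromℕℚ (suc d))
    ≈⟨ ℚ.toℚᵘ-homo-* (+ m ℚ./ suc d) (fromℕℚ (suc d)) ⟩
  ℚ.toℚᵘ (+ m ℚ./ suc d) ℚᵘ.* ℚ.toℚᵘ (fromℕℚ (suc d))
    ≈⟨ ℚᵘ.*-cong (ℚ.toℚᵘ-fromℚᵘ (ℚᵘ.mkℚᵘ (+ m) d)) (ℚ.toℚᵘ-fromℚᵘ (ℚᵘ.mkℚᵘ (+ suc d) 0)) ⟩
  ℚᵘ.mkℚᵘ (+ m) d ℚᵘ.* ℚᵘ.mkℚᵘ (+ suc d) 0
    ≈⟨ ℚᵘ.*≡* (ℤ.*-assoc (+ m) (+ suc d) (+ 1)) ⟩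
  ℚᵘ.mkℚᵘ (+ m) 0
    ≈⟨ ℚ.toℚᵘ-fromℚᵘ (ℚᵘ.mkℚᵘ (+ m) 0) ⟨
  ℚ.toℚᵘ (fromℕℚ m) ∎)
  where open ℚᵘ.≃-Reasoning

fromℕℚ-* : ∀ m n → fromℕℚ (m ℕ.* n) ≡ fromℕℚ m ℚ.* fromℕℚ n
fromℕℚ-* m n = ℚ.toℚᵘ-injective (begin
  ℚ.toℚᵘ (fromℕℚ (m ℕ.* n))                    ≈⟨ ℚ.toℚᵘ-fromℚᵘ (ℚᵘ.mkℚᵘ (+ (m ℕ.* n)) 0) ⟩
  ℚᵘ.mkℚᵘ (+ (m ℕ.* n)) 0
    ≡⟨ cong (λ i → ℚᵘ.mkℚᵘ i 0) (ℤ.pos-* m n) ⟩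
  ℚᵘ.mkℚᵘ (+ m) 0 ℚᵘ.* ℚᵘ.mkℚᵘ (+ n) 0
    ≈⟨ ℚᵘ.*-cong (ℚ.toℚᵘ-fromℚᵘ (ℚᵘ.mkℚᵘ (+ m) 0)) (ℚ.toℚᵘ-fromℚᵘ (ℚᵘ.mkℚᵘ (+ n) 0)) ⟨
  ℚ.toℚᵘ (fromℕℚ m) ℚᵘ.* ℚ.toℚᵘ (fromℕℚ n)     ≈⟨ ℚ.toℚᵘ-homo-* (fromℕℚ m) (fromℕℚ n) ⟨
  ℚ.toℚᵘ (fromℕℚ m ℚ.* fromℕℚ n)               ∎)
  where open ℚᵘ.≃-Reasoning

fromℕℚ-+ : ∀ m n → fromℕℚ (m ℕ.+ n) ≡ fromℕℚ m ℚ.+ fromℕℚ n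
fromℕℚ-+ m n = ℚ.toℚᵘ-injective (begin
  ℚ.toℚᵘ (fromℕℚ (m ℕ.+ n))                    ≈⟨ ℚ.toℚᵘ-fromℚᵘ (ℚᵘ.mkℚᵘ (+ (m ℕ.+ n)) 0) ⟩
  ℚᵘ.mkℚᵘ (+ (m ℕ.+ n)) 0
    ≡⟨ cong (λ i → ℚᵘ.mkℚᵘ i 0)
         (cong₂ ℤ._+_ (ℤ.*-identityʳ (+ m)) (ℤ.*-identityʳ (+ n))) ⟨
  ℚᵘ.mkℚᵘ (+ m) 0 ℚᵘ.+ ℚᵘ.mkℚᵘ (+ n) 0
    ≈⟨ ℚᵘ.+-cong (ℚ.toℚᵘ-fromℚᵘ (ℚᵘ.mkℚᵘ (+ m) 0)) (ℚ.toℚᵘ-fromℚᵘ (ℚᵘ.mkℚᵘ (+ n) 0)) ⟨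
  ℚ.toℚᵘ (fromℕℚ m) ℚᵘ.+ ℚ.toℚᵘ (fromℕℚ n)     ≈⟨ ℚ.toℚᵘ-homo-+ (fromℕℚ m) (fromℕℚ n) ⟨
  ℚ.toℚᵘ (fromℕℚ m ℚ.+ fromℕℚ n)               ∎)
  where open ℚᵘ.≃-Reasoning

fromℕℚ-mono-< : ∀ {m n} → m ℕ.< n → fromℕℚ m ℚ.< fromℕℚ n
fromℕℚ-mono-< {m} {n} m<n = ℚ.toℚᵘ-cancel-< (
  ℚᵘ.<-respˡ-≃ (ℚᵘ.≃-sym (ℚ.toℚᵘ-fromℚᵘ (ℚᵘ.mkℚᵘ (+ m) 0)))
  (ℚᵘ.<-respʳ-≃ (ℚᵘ.≃-sym (ℚ.toℚᵘ-fromℚᵘ (ℚᵘ.mkℚᵘ (+ n) 0)))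
  (ℚᵘ.*<* (subst₂ ℤ._<_ (sym (ℤ.*-identityʳ (+ m))) (sym (ℤ.*-identityʳ (+ n))) (ℤ.+<+ m<n)))))

fromℕℚ-mono-≤ : ∀ {m n} → m ℕ.≤ n → fromℕℚ m ℚ.≤ fromℕℚ n
fromℕℚ-mono-≤ {m} {n} m≤n with ℕ.m≤n⇒m<n∨m≡n m≤n
... | inj₁ m<n = ℚ.<⇒≤ (fromℕℚ-mono-< m<n)
... | inj₂ refl = ℚ.≤-refl

fromℕℚ-pos : ∀ n .{{_ : ℕ.NonZero n}} → ℚ.Positive (fromℕℚ n)
fromℕℚ-pos (suc n) = ℚ.normalize-pos (suc n) 1

fromℕℚ-∣↥∣ : ∀ q → 0ℚ ℚ.≤ q → q ℚ.* fromℕℚ (↧ₙ q) ≡ fromℕℚ ℤ.∣ ↥ q ∣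
fromℕℚ-∣↥∣ q@(ℚ.mkℚ _ _ _) 0≤q = subst (λ p → p ℚ.* fromℕℚ (↧ₙ q) ≡ fromℕℚ ℤ.∣ ↥ q ∣)
  (trans (cong (ℚ._/ ↧ₙ q) (ℤ.0≤i⇒+∣i∣≡i 0≤↥q)) (ℚ.↥p/↧p≡p q))
  (/-*-cancel ℤ.∣ ↥ q ∣ (↧ₙ q))
  where
  0≤↥q : + 0 ℤ.≤ ↥ q
  0≤↥q = subst (+ 0 ℤ.≤_) (ℤ.*-identityʳ (↥ q)) (ℚ.drop-*≤* 0≤q)

archimedean : ∀ {ε} → 0ℚ ℚ.< ε → ∃[ N ] ∀ {n} → N ℕ.≤ n → + 1 ℚ./ suc n ℚ.≤ ε
archimedean {ε} 0<ε = ↧ₙ ε , λ {n} b≤n →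
  ℚ.*-cancelʳ-≤-pos (fromℕℚ (suc n)) {{fromℕℚ-pos (suc n)}} (begin
    (+ 1 ℚ./ suc n) ℚ.* fromℕℚ (suc n)  ≡⟨ /-*-cancel 1 (suc n) ⟩
    fromℕℚ 1                            ≤⟨ fromℕℚ-mono-≤ 1≤∣↥ε∣ ⟩
    fromℕℚ ℤ.∣ ↥ ε ∣                    ≡⟨ fromℕℚ-∣↥∣ ε (ℚ.<⇒≤ 0<ε) ⟨
    ε ℚ.* fromℕℚ (↧ₙ ε)
      ≤⟨ ℚ.*-monoˡ-≤-nonNeg ε {{ℚ.nonNegative (ℚ.<⇒≤ 0<ε)}}
           (fromℕℚ-mono-≤ (ℕ.m≤n⇒m≤1+n b≤n)) ⟩
    ε ℚ.* fromℕℚ (suc n)                ∎)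
  where
  open ℚ.≤-Reasoning
  1≤∣↥ε∣ : 1 ℕ.≤ ℤ.∣ ↥ ε ∣
  1≤∣↥ε∣ = ℕ.n≢0⇒n>0 λ eq → ℚ.<⇒≢ 0<ε (sym (ℚ.↥p≡0⇒p≡0 ε (ℤ.∣i∣≡0⇒i≡0 eq)))

-- ⌊√n⌋
isqrt : ℕ → ℕ
isqrt zero = 0
isqrt (suc n) with suc (isqrt n) ℕ.* suc (isqrt n) ℕ.≤? suc n
... | yes _ = suc (isqrt n)
... | no  _ = isqrt n

isqrt-spec : ∀ n → isqrt n ℕ.* isqrt n ℕ.≤ n × n ℕ.< suc (isqrt n) ℕ.* suc (isqrt n)
isqrt-spec zero = ℕ.z≤n , ℕ.s≤s ℕ.z≤n
isqrt-spec (suc n) with suc (isqrt n) ℕ.* suc (isqrt n) ℕ.≤? suc n | isqrt-spec n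
... | yes p | _ , hi =
  p , ℕ.≤-<-trans hi (ℕ.*-mono-< (ℕ.n<1+n (suc (isqrt n))) (ℕ.n<1+n (suc (isqrt n))))
... | no ¬p | lo , _ = ℕ.m≤n⇒m≤1+n lo , ℕ.≰⇒> ¬p

opaque
  -- For q = a / b ≥ 0 this is ⌊b (n+1) √q⌋ / (b (n+1)), since b √q = √(a b);
  -- negative q is treated as 0.
  sqrtApprox : ℕ → ℚ → ℚ
  sqrtApprox n q = + isqrt (a ℕ.* b ℕ.* (suc n ℕ.* suc n)) ℚ./ (b ℕ.* suc n)
    where
    a b : ℕ
    a = ℤ.∣ ↥ (q ℚ.⊔ 0ℚ) ∣
    b = ↧ₙ (q ℚ.⊔ 0ℚ)

module _ (n : ℕ) (q : ℚ) where
  private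
    p r c : ℚ
    a b N A s : ℕ
    p = q ℚ.⊔ 0ℚ
    r = sqrtApprox n q
    a = ℤ.∣ ↥ p ∣
    b = ↧ₙ p
    N = suc n
    A = a ℕ.* b ℕ.* (N ℕ.* N)
    s = isqrt A
    c = fromℕℚ (b ℕ.* N)

    instance
      c-pos : ℚ.Positive c
      c-pos = fromℕℚ-pos (b ℕ.* N)

      c*c-pos : ℚ.Positive (c ℚ.* c)
      c*c-pos = ℚ.pos*pos⇒pos c c

    opaque
      unfolding sqrtApprox
      r≡s/bN : r ≡ + s ℚ./ (b ℕ.* N)
      r≡s/bN = refl

    r*c : r ℚ.* c ≡ fromℕℚ s
    r*c = trans (cong (ℚ._* c) r≡s/bN) (/-*-cancel s (b ℕ.* N))

    interchange : ∀ x y → (x ℚ.* x) ℚ.* (y ℚ.* y) ≡ (x ℚ.* y) ℚ.* (x ℚ.* y)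
    interchange = solve 2 (λ x y → (x :* x) :* (y :* y) := (x :* y) :* (x :* y)) refl
      where open ℚ-Solver

    p*cc : p ℚ.* (c ℚ.* c) ≡ fromℕℚ A
    p*cc = begin
      p ℚ.* (c ℚ.* c)
        ≡⟨ cong (λ x → p ℚ.* (x ℚ.* x)) (fromℕℚ-* b N) ⟩
      p ℚ.* ((fromℕℚ b ℚ.* fromℕℚ N) ℚ.* (fromℕℚ b ℚ.* fromℕℚ N))
        ≡⟨ solve 3 (λ p b N → p :* ((b :* N) :* (b :* N)) := ((p :* b) :* b) :* (N :* N))
             refl p (fromℕℚ b) (fromℕℚ N) ⟩
      ((p ℚ.* fromℕℚ b) ℚ.* fromℕℚ b) ℚ.* (fromℕℚ N ℚ.* fromℕℚ N)
        ≡⟨ cong₂ (λ x y → (x ℚ.* fromℕℚ b) ℚ.* y)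
             (fromℕℚ-∣↥∣ p (ℚ.p≤q⊔p q 0ℚ)) (sym (fromℕℚ-* N N)) ⟩
      (fromℕℚ a ℚ.* fromℕℚ b) ℚ.* fromℕℚ (N ℕ.* N)
        ≡⟨ cong (ℚ._* fromℕℚ (N ℕ.* N)) (fromℕℚ-* a b) ⟨
      fromℕℚ (a ℕ.* b) ℚ.* fromℕℚ (N ℕ.* N)
        ≡⟨ fromℕℚ-* (a ℕ.* b) (N ℕ.* N) ⟨
      fromℕℚ A ∎
      where
      open ≡-Reasoning
      open ℚ-Solver

    step : ℚ
    step = + 1 ℚ./ suc n

    [r+step]*c : (r ℚ.+ step) ℚ.* c ≡ fromℕℚ (s ℕ.+ b)
    [r+step]*c = begin
      (r ℚ.+ step) ℚ.* c                           ≡⟨ ℚ.*-distribʳ-+ c r step ⟩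
      r ℚ.* c ℚ.+ step ℚ.* c                       ≡⟨ cong₂ (λ x y → x ℚ.+ step ℚ.* y) r*c (fromℕℚ-* b N) ⟩
      fromℕℚ s ℚ.+ step ℚ.* (fromℕℚ b ℚ.* fromℕℚ N)
        ≡⟨ solve 4 (λ s t b N → s :+ t :* (b :* N) := s :+ (t :* N) :* b)
             refl (fromℕℚ s) step (fromℕℚ b) (fromℕℚ N) ⟩
      fromℕℚ s ℚ.+ (step ℚ.* fromℕℚ N) ℚ.* fromℕℚ b
        ≡⟨ cong (λ x → fromℕℚ s ℚ.+ x ℚ.* fromℕℚ b) (/-*-cancel 1 N) ⟩
      fromℕℚ s ℚ.+ 1ℚ ℚ.* fromℕℚ b                 ≡⟨ cong (fromℕℚ s ℚ.+_) (ℚ.*-identityˡ _) ⟩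
      fromℕℚ s ℚ.+ fromℕℚ b                        ≡⟨ fromℕℚ-+ s b ⟨
      fromℕℚ (s ℕ.+ b)                             ∎
      where
      open ≡-Reasoning
      open ℚ-Solver

  sqrtApprox-nonNeg : 0ℚ ℚ.≤ r
  sqrtApprox-nonNeg = subst (0ℚ ℚ.≤_) (sym r≡s/bN)
    (ℚ.nonNegative⁻¹ (+ s ℚ./ (b ℕ.* N)) {{ℚ.normalize-nonNeg s (b ℕ.* N)}})

  sqrtApprox-lower : r ℚ.* r ℚ.≤ p
  sqrtApprox-lower = ℚ.*-cancelʳ-≤-pos (c ℚ.* c) (begin
    (r ℚ.* r) ℚ.* (c ℚ.* c)  ≡⟨ interchange r c ⟩
    (r ℚ.* c) ℚ.* (r ℚ.* c)  ≡⟨ cong₂ ℚ._*_ r*c r*c ⟩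
    fromℕℚ s ℚ.* fromℕℚ s    ≡⟨ fromℕℚ-* s s ⟨
    fromℕℚ (s ℕ.* s)         ≤⟨ fromℕℚ-mono-≤ (proj₁ (isqrt-spec A)) ⟩
    fromℕℚ A                 ≡⟨ p*cc ⟨
    p ℚ.* (c ℚ.* c)          ∎)
    where open ℚ.≤-Reasoning

  sqrtApprox-upper : p ℚ.< (r ℚ.+ step) ℚ.* (r ℚ.+ step)
  sqrtApprox-upper = ℚ.*-cancelʳ-<-nonNeg (c ℚ.* c) {{ℚ.pos⇒nonNeg (c ℚ.* c)}} (begin-strict
    p ℚ.* (c ℚ.* c)                                ≡⟨ p*cc ⟩
    fromℕℚ A                                       <⟨ fromℕℚ-mono-< (proj₂ (isqrt-spec A)) ⟩
    fromℕℚ (suc s ℕ.* suc s)                       ≤⟨ fromℕℚ-mono-≤ (ℕ.*-mono-≤ s+1≤s+b s+1≤s+b) ⟩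
    fromℕℚ ((s ℕ.+ b) ℕ.* (s ℕ.+ b))               ≡⟨ fromℕℚ-* (s ℕ.+ b) (s ℕ.+ b) ⟩
    fromℕℚ (s ℕ.+ b) ℚ.* fromℕℚ (s ℕ.+ b)          ≡⟨ cong₂ ℚ._*_ [r+step]*c [r+step]*c ⟨
    ((r ℚ.+ step) ℚ.* c) ℚ.* ((r ℚ.+ step) ℚ.* c)  ≡⟨ interchange (r ℚ.+ step) c ⟨
    ((r ℚ.+ step) ℚ.* (r ℚ.+ step)) ℚ.* (c ℚ.* c)  ∎)
    where
    open ℚ.≤-Reasoning
    s+1≤s+b : suc s ℕ.≤ s ℕ.+ b
    s+1≤s+b = subst (ℕ._≤ s ℕ.+ b) (ℕ.+-comm s 1) (ℕ.+-monoʳ-≤ s (ℕ.s≤s ℕ.z≤n))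

-- ℝ below consists of Cauchy sequences of rationals, to be compared with _≈_, not _≡_.
IsCauchy : (ℕ → ℚ) → Set
IsCauchy x = ∀ ε → 0ℚ ℚ.< ε →
  ∃[ N ] ∀ {m n} → N ℕ.≤ m → N ℕ.≤ n → ∣ x m ℚ.- x n ∣ ℚ.< ε

record ℝ : Set where
  constructor mkℝ
  field
    seq    : ℕ → ℚ
    cauchy : IsCauchy seq

open ℝ public

infix  4 _≈_
infixl 6 _+_
infixl 7 _*_
infix  8 √_
infix  9 _²

-- Equality of real numbers: the difference of the sequences tends to 0.
_≈_ : Rel ℝ 0ℓ
x ≈ y = ∀ ε → 0ℚ ℚ.< ε → ∃[ N ] ∀ {n} → N ℕ.≤ n → ∣ seq x n ℚ.- seq y n ∣ ℚ.< ε

fromℚ : ℚ → ℝ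
fromℚ q = mkℝ (λ _ → q) λ ε 0<ε →
  0 , λ _ _ → subst (λ d → ∣ d ∣ ℚ.< ε) (sym (ℚ.+-inverseʳ q)) 0<ε

fromℕ : ℕ → ℝ
fromℕ n = fromℚ (fromℕℚ n)

0ℝ : ℝ
0ℝ = fromℚ 0ℚ

_+_ : ℝ → ℝ → ℝ
x + y = mkℝ (λ n → seq x n ℚ.+ seq y n) λ ε 0<ε →
  let N₁ , p = cauchy x (½ ℚ.* ε) (half-pos 0<ε)
      N₂ , q = cauchy y (½ ℚ.* ε) (half-pos 0<ε)
  in N₁ ℕ.⊔ N₂ , λ {m} {n} ≤m ≤n → begin-strict
    ∣ (seq x m ℚ.+ seq y m) ℚ.- (seq x n ℚ.+ seq y n) ∣
      ≡⟨ cong ∣_∣ (regroup (seq x m) (seq y m) (seq x n) (seq y n)) ⟩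
    ∣ (seq x m ℚ.- seq x n) ℚ.+ (seq y m ℚ.- seq y n) ∣
      ≤⟨ ℚ.∣p+q∣≤∣p∣+∣q∣ (seq x m ℚ.- seq x n) (seq y m ℚ.- seq y n) ⟩
    ∣ seq x m ℚ.- seq x n ∣ ℚ.+ ∣ seq y m ℚ.- seq y n ∣
      <⟨ ℚ.+-mono-< (p (ℕ.m⊔n≤o⇒m≤o N₁ N₂ ≤m) (ℕ.m⊔n≤o⇒m≤o N₁ N₂ ≤n))
                    (q (ℕ.m⊔n≤o⇒n≤o N₁ N₂ ≤m) (ℕ.m⊔n≤o⇒n≤o N₁ N₂ ≤n)) ⟩
    ½ ℚ.* ε ℚ.+ ½ ℚ.* ε
      ≡⟨ halves ε ⟩
    ε ∎
  where
  open ℚ.≤-Reasoning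
  open ℚ-Solver
  regroup : ∀ a b c d → (a ℚ.+ b) ℚ.- (c ℚ.+ d) ≡ (a ℚ.- c) ℚ.+ (b ℚ.- d)
  regroup = solve 4 (λ a b c d → (a :+ b) :- (c :+ d) := (a :- c) :+ (b :- d)) refl

eventually-bounded : ∀ x → ∃[ B ] 0ℚ ℚ.< B × ∃[ N ] ∀ {n} → N ℕ.≤ n → ∣ seq x n ∣ ℚ.≤ B
eventually-bounded x = B , 0<B , N , λ {n} N≤n → begin
    ∣ seq x n ∣
      ≡⟨ cong ∣_∣ (regroup (seq x n) (seq x N)) ⟩
    ∣ seq x N ℚ.+ (seq x n ℚ.- seq x N) ∣
      ≤⟨ ℚ.∣p+q∣≤∣p∣+∣q∣ (seq x N) (seq x n ℚ.- seq x N) ⟩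
    ∣ seq x N ∣ ℚ.+ ∣ seq x n ℚ.- seq x N ∣
      ≤⟨ ℚ.+-monoʳ-≤ ∣ seq x N ∣ (ℚ.<⇒≤ (p N≤n ℕ.≤-refl)) ⟩
    B ∎
  where
  0<1 : 0ℚ ℚ.< 1ℚ
  0<1 = ℚ.positive⁻¹ 1ℚ
  N = proj₁ (cauchy x 1ℚ 0<1)
  p = proj₂ (cauchy x 1ℚ 0<1)
  B = ∣ seq x N ∣ ℚ.+ 1ℚ
  0<B : 0ℚ ℚ.< B
  0<B = ℚ.+-mono-≤-< (ℚ.0≤∣p∣ (seq x N)) 0<1
  open ℚ.≤-Reasoning
  open ℚ-Solver
  regroup : ∀ a b → a ≡ b ℚ.+ (a ℚ.- b)
  regroup = solve 2 (λ a b → a := b :+ (a :- b)) refl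

_*_ : ℝ → ℝ → ℝ
x * y = mkℝ (λ n → seq x n ℚ.* seq y n) λ ε 0<ε →
  let Bx , 0<Bx , Mx , bx = eventually-bounded x
      By , 0<By , My , by = eventually-bounded y
      δx , 0<δx , δx*By≡ε/2 = quotient 0<By (half-pos 0<ε)
      δy , 0<δy , δy*Bx≡ε/2 = quotient 0<Bx (half-pos 0<ε)
      Nx , px = cauchy x δx 0<δx
      Ny , py = cauchy y δy 0<δy
      N = Nx ℕ.⊔ Ny
      M = Mx ℕ.⊔ My
  in N ℕ.⊔ M , λ {m} {n} ≤m ≤n →
    let N≤m = ℕ.m⊔n≤o⇒m≤o N M ≤m
        N≤n = ℕ.m⊔n≤o⇒m≤o N M ≤n
        M≤m = ℕ.m⊔n≤o⇒n≤o N M ≤m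
        M≤n = ℕ.m⊔n≤o⇒n≤o N M ≤n
    in subst (∣ seq x m ℚ.* seq y m ℚ.- seq x n ℚ.* seq y n ∣ ℚ.<_)
      (trans (cong₂ ℚ._+_ δy*Bx≡ε/2 δx*By≡ε/2) (halves ε))
      (product-close (seq x m) (seq y m) (seq x n) (seq y n) 0<Bx 0<By
        (bx (ℕ.m⊔n≤o⇒m≤o Mx My M≤m))
        (by (ℕ.m⊔n≤o⇒n≤o Mx My M≤n))
        (px (ℕ.m⊔n≤o⇒m≤o Nx Ny N≤m) (ℕ.m⊔n≤o⇒m≤o Nx Ny N≤n))
        (py (ℕ.m⊔n≤o⇒n≤o Nx Ny N≤m) (ℕ.m⊔n≤o⇒n≤o Nx Ny N≤n)))

_² : ℝ → ℝ
x ² = x * x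

sqrt-cauchy : ∀ x → IsCauchy x → IsCauchy (λ n → sqrtApprox n (x n))
sqrt-cauchy x cx ε 0<ε =
  let 0<h = half-pos 0<ε
      M , close = cx (½ ℚ.* ε ℚ.* (½ ℚ.* ε)) (*-pos 0<h 0<h)
      N , small = archimedean 0<h
      M≤ : ∀ {n} → M ℕ.⊔ N ℕ.≤ n → M ℕ.≤ n
      M≤ = ℕ.m⊔n≤o⇒m≤o M N
      N≤ : ∀ {n} → M ℕ.⊔ N ℕ.≤ n → N ℕ.≤ n
      N≤ = ℕ.m⊔n≤o⇒n≤o M N
      below : ∀ {m n} → M ℕ.⊔ N ℕ.≤ m → M ℕ.⊔ N ℕ.≤ n →
        sqrtApprox m (x m) ℚ.- sqrtApprox n (x n) ℚ.< ε
      below {m} {n} ≤m ≤n = root-close (ℚ.<⇒≤ 0<h) (halves ε)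
        (sqrtApprox-nonNeg m (x m)) (sqrtApprox-nonNeg n (x n)) (1/suc-nonNeg n)
        (sqrtApprox-lower m (x m)) (sqrtApprox-upper n (x n))
        (⊔0-nonexpansive (x m) (x n)) (close (M≤ ≤m) (M≤ ≤n)) (small (N≤ ≤n))
  in M ℕ.⊔ N , λ {m} {n} ≤m ≤n → ∣p∣<q (below ≤m ≤n)
       (subst (ℚ._< ε) (neg-swap (sqrtApprox n (x n)) (sqrtApprox m (x m))) (below ≤n ≤m))

-- Total function: √ x is 0 for negative x.
√_ : ℝ → ℝ
√ x = mkℝ (λ n → sqrtApprox n (seq x n)) (sqrt-cauchy (seq x) (cauchy x))

sumℝ : List ℝ → ℝ
sumℝ = foldr _+_ 0ℝ

record Graph (n : ℕ) : Set₁ where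
  field
    Adj    : Rel (Fin n) 0ℓ
    adj?   : Decidable Adj
    symm   : Symmetric Adj
    irrefl : Irreflexive _≡_ Adj

open Graph public

complement : ∀ {n} → Graph n → Graph n
complement G = record
  { Adj    = λ u v → u ≢ v × ¬ Adj G u v
  ; adj?   = λ u v → ¬? (u Fin.≟ v) ×-dec ¬? (adj? G u v)
  ; symm   = λ (u≢v , ¬uv) → ≢-sym u≢v , λ vu → ¬uv (symm G vu)
  ; irrefl = λ u≡v (u≢v , _) → u≢v u≡v
  }

complete : ∀ n → Graph n
complete n = record
  { Adj    = _≢_
  ; adj?   = λ u v → ¬? (u Fin.≟ v)
  ; symm   = ≢-sym
  ; irrefl = λ u≡v u≢v → u≢v u≡v
  }

degree : ∀ {n} → Graph n → Fin n → ℕ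
degree {n} G u = length (filter (adj? G u) (allFin n))

IsRegular : ∀ {n} → Graph n → ℕ → Set
IsRegular G k = ∀ u → degree G u ≡ k

-- Each unordered edge is listed once, as the pair (u , v) with u < v.
edges : ∀ {n} → Graph n → List (Fin n × Fin n)
edges {n} G = filter (λ (u , v) → (u Fin.<? v) ×-dec adj? G u v)
  (cartesianProduct (allFin n) (allFin n))

SO : ∀ {n} → Graph n → ℝ
SO G = sumℝ (map (λ (u , v) → √ (fromℕ (degree G u) ² + fromℕ (degree G v) ²)) (edges G))

module Submission where

-- A k-regular graph on n vertices has nk/2 edges, each contributing √(k² + k²) = k√2, so that
-- SO(G) = k² τ² with τ = √((n/2)√2) depending on n only, i.e. √SO(G) = kτ. The complement is
-- regular of degree n-1-k and Kₙ is regular of degree n-1, so the claim becomes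
-- ((n-1) τ)² = (kτ + (n-1-k) τ)².

open import Defs
open import Data.Nat.Base using (ℕ)
import Algebra.Properties.CommutativeMonoid.Sum
open import Data.Fin.Base as Fin using (Fin; zero; suc; punchIn)
import Data.Fin.Properties as Fin
open import Data.Integer.Base using (+_)
open import Data.List.Base
  using ([]; _∷_; _++_; cartesianProduct; filter; length; map; tabulate)
open import Data.List.Properties using (filter-++; length-++; map-tabulate)
open import Data.Nat.Base as ℕ using (zero; suc)
import Data.Nat.Properties as ℕ
open import Data.Product.Base using (_×_; _,_; proj₁; proj₂)
open import Data.Rational.Base as ℚ using (ℚ; 0ℚ; 1ℚ; ½; ∣_∣)
import Data.Rational.Properties as ℚ
open import Data.Rational.Solver using () renaming (module +-*-Solver to ℚ-Solver)
open import Data.Sum.Base using (_⊎_; inj₁; inj₂; [_,_]′)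
open import Function.Base using (_∘_; id)
open import Relation.Binary.Bundles using (Setoid)
open import Relation.Binary.Definitions using (tri<; tri≈; tri>)
import Relation.Binary.Reasoning.Setoid as SetoidReasoning
open import Relation.Binary.PropositionalEquality
  using (_≡_; _≢_; _≗_; ≢-sym; refl; sym; trans; cong; cong₂; subst; subst₂;
         module ≡-Reasoning)
open import Relation.Nullary using (Dec; ¬_; _×-dec_; yes; no; contradiction)
open import Relation.Unary using (Pred; Decidable)

open Algebra.Properties.CommutativeMonoid.Sum ℕ.+-0-commutativeMonoid
  using (sum-syntax; sum-cong-≗; sum-remove; ∑-distrib-+; ∑-comm)

-- Counting with Iverson brackets

⟦_⟧ : ∀ {p} {P : Set p} → Dec P → ℕ
⟦ yes _ ⟧ = 1
⟦ no  _ ⟧ = 0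

⟦⟧-true : ∀ {p} {P : Set p} (P? : Dec P) → P → ⟦ P? ⟧ ≡ 1
⟦⟧-true (yes _) _ = refl
⟦⟧-true (no ¬p) p = contradiction p ¬p

⟦⟧-false : ∀ {p} {P : Set p} (P? : Dec P) → ¬ P → ⟦ P? ⟧ ≡ 0
⟦⟧-false (yes p) ¬p = contradiction p ¬p
⟦⟧-false (no _)  _  = refl

-- Turns an exclusive case distinction into a sum of indicators. It serves two splittings below:
-- adjacency in the complete graph into `G` and its complement, and adjacency in `G` into the two
-- orders of the endpoints.
⟦⟧-⊎ : ∀ {p q r} {P : Set p} {Q : Set q} {R : Set r} (P? : Dec P) (Q? : Dec Q) (R? : Dec R) →
  (P → Q ⊎ R) → (Q → P) → (R → P) → (Q → ¬ R) → ⟦ P? ⟧ ≡ ⟦ Q? ⟧ ℕ.+ ⟦ R? ⟧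
⟦⟧-⊎ P?      (yes q) (yes r) _ _   _   disj = contradiction r (disj q)
⟦⟧-⊎ P?      (yes q) (no _)  _ q⇒p _   _    = ⟦⟧-true P? (q⇒p q)
⟦⟧-⊎ P?      (no _)  (yes r) _ _   r⇒p _    = ⟦⟧-true P? (r⇒p r)
⟦⟧-⊎ P?      (no ¬q) (no ¬r) p⇒ _  _   _    = ⟦⟧-false P? ([ ¬q , ¬r ]′ ∘ p⇒)

-- Covers `allFin n`, which is `tabulate id`. The function `f` is arbitrary because the induction
-- passes from `f` to `f ∘ suc`.
length-filter-tabulate : ∀ {a p} {A : Set a} {P : Pred A p} (P? : Decidable P) {n} (f : Fin n → A) →
  length (filter P? (tabulate f)) ≡ ∑[ i < n ] ⟦ P? (f i) ⟧
length-filter-tabulate P? {zero}  f = refl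
length-filter-tabulate P? {suc n} f with P? (f zero)
... | yes _ = cong suc (length-filter-tabulate P? (f ∘ suc))
... | no  _ = length-filter-tabulate P? (f ∘ suc)

length-filter-cartesianProduct :
  ∀ {a b p} {A : Set a} {B : Set b} {P : Pred (A × B) p} (P? : Decidable P)
  {m n} (f : Fin m → A) (g : Fin n → B) →
  length (filter P? (cartesianProduct (tabulate f) (tabulate g)))
    ≡ ∑[ i < m ] ∑[ j < n ] ⟦ P? (f i , g j) ⟧
length-filter-cartesianProduct P? {zero} f g = refl
length-filter-cartesianProduct P? {suc m} {n} f g = begin
  length (filter P? (row ++ rest))
    ≡⟨ cong length (filter-++ P? row rest) ⟩
  length (filter P? row ++ filter P? rest)
    ≡⟨ length-++ (filter P? row) ⟩
  length (filter P? row) ℕ.+ length (filter P? rest)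
    ≡⟨ cong₂ ℕ._+_
         (trans (cong (length ∘ filter P?) (map-tabulate g (f zero ,_)))
                (length-filter-tabulate P? (λ j → f zero , g j)))
         (length-filter-cartesianProduct P? (f ∘ suc) g) ⟩
  ∑[ i < suc m ] ∑[ j < n ] ⟦ P? (f i , g j) ⟧ ∎
  where
  open ≡-Reasoning
  row  = map (f zero ,_) (tabulate g)
  rest = cartesianProduct (tabulate (f ∘ suc)) (tabulate g)

∑-const : ∀ n k → ∑[ i < n ] k ≡ n ℕ.* k
∑-const zero    k = refl
∑-const (suc n) k = cong (k ℕ.+_) (∑-const n k)

-- Degrees and the number of edges

degree≡∑ : ∀ {n} (G : Graph n) u → degree G u ≡ ∑[ v < n ] ⟦ adj? G u v ⟧
degree≡∑ G u = length-filter-tabulate (adj? G u) id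

-- A vertex other than `u` is adjacent to `u` in exactly one of `G` and its complement, and `u`
-- itself in neither.
degree-complement : ∀ {n} (G : Graph n) u →
  degree (complete n) u ≡ degree G u ℕ.+ degree (complement G) u
degree-complement {n} G u = begin
  degree (complete n) u
    ≡⟨ degree≡∑ (complete n) u ⟩
  ∑[ v < n ] ⟦ adj? (complete n) u v ⟧
    ≡⟨ sum-cong-≗ split ⟩
  ∑[ v < n ] (⟦ adj? G u v ⟧ ℕ.+ ⟦ adj? (complement G) u v ⟧)
    ≡⟨ ∑-distrib-+ (λ v → ⟦ adj? G u v ⟧) (λ v → ⟦ adj? (complement G) u v ⟧) ⟩
  ∑[ v < n ] ⟦ adj? G u v ⟧ ℕ.+ ∑[ v < n ] ⟦ adj? (complement G) u v ⟧
    ≡⟨ cong₂ ℕ._+_ (degree≡∑ G u) (degree≡∑ (complement G) u) ⟨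
  degree G u ℕ.+ degree (complement G) u ∎
  where
  open ≡-Reasoning
  split : ∀ v → ⟦ adj? (complete n) u v ⟧ ≡ ⟦ adj? G u v ⟧ ℕ.+ ⟦ adj? (complement G) u v ⟧
  split v = ⟦⟧-⊎ (adj? (complete n) u v) (adj? G u v) (adj? (complement G) u v)
    cases (λ uv u≡v → irrefl G u≡v uv) proj₁ (λ uv (_ , ¬uv) → ¬uv uv)
    where
    cases : u ≢ v → Adj G u v ⊎ Adj (complement G) u v
    cases u≢v with adj? G u v
    ... | yes uv = inj₁ uv
    ... | no ¬uv = inj₂ (u≢v , ¬uv)

degree-complete : ∀ n → IsRegular (complete (suc n)) n
degree-complete n u = begin
  degree K u
    ≡⟨ degree≡∑ K u ⟩
  ∑[ v < suc n ] ⟦ adj? K u v ⟧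
    -- The diagonal term `v = u` is taken out; `punchIn u` enumerates the other `n` vertices.
    ≡⟨ sum-remove {i = u} (λ v → ⟦ adj? K u v ⟧) ⟩
  ⟦ adj? K u u ⟧ ℕ.+ ∑[ j < n ] ⟦ adj? K u (punchIn u j) ⟧
    ≡⟨ cong₂ ℕ._+_ (⟦⟧-false (adj? K u u) (λ u≢u → u≢u refl))
         (sum-cong-≗ λ j → ⟦⟧-true (adj? K u (punchIn u j)) (≢-sym (Fin.punchInᵢ≢i u j))) ⟩
  ∑[ j < n ] 1
    ≡⟨ ∑-const n 1 ⟩
  n ℕ.* 1
    ≡⟨ ℕ.*-identityʳ n ⟩
  n ∎
  where
  open ≡-Reasoning
  K = complete (suc n)

-- Double counting: an adjacent pair `u`, `v` contributes to both degrees, but `edges` lists it only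
-- in increasing order. The doubled edge count keeps the statement free of division.
handshake : ∀ {n} (G : Graph n) → ∑[ u < n ] degree G u ≡ length (edges G) ℕ.+ length (edges G)
handshake {n} G = begin
  ∑[ u < n ] degree G u
    ≡⟨ sum-cong-≗ (λ u → trans (degree≡∑ G u) (sum-cong-≗ (split u))) ⟩
  ∑[ u < n ] ∑[ v < n ] (E u v ℕ.+ E v u)
    ≡⟨ sum-cong-≗ (λ u → ∑-distrib-+ (E u) (λ v → E v u)) ⟩
  ∑[ u < n ] (∑[ v < n ] E u v ℕ.+ ∑[ v < n ] E v u)
    ≡⟨ ∑-distrib-+ (λ u → ∑[ v < n ] E u v) (λ u → ∑[ v < n ] E v u) ⟩
  ∑[ u < n ] ∑[ v < n ] E u v ℕ.+ ∑[ u < n ] ∑[ v < n ] E v u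
    -- Exchanging the two summations turns the pairs listed as `E v u` into those listed as `E u v`.
    ≡⟨ cong (∑[ u < n ] ∑[ v < n ] E u v ℕ.+_) (∑-comm (λ u v → E v u)) ⟩
  ∑[ u < n ] ∑[ v < n ] E u v ℕ.+ ∑[ u < n ] ∑[ v < n ] E u v
    ≡⟨ cong₂ ℕ._+_ count count ⟨
  length (edges G) ℕ.+ length (edges G) ∎
  where
  open ≡-Reasoning
  edge? : ∀ u v → Dec (u Fin.< v × Adj G u v)
  edge? u v = (u Fin.<? v) ×-dec adj? G u v

  E : Fin n → Fin n → ℕ
  E u v = ⟦ edge? u v ⟧

  count : length (edges G) ≡ ∑[ u < n ] ∑[ v < n ] E u v
  count = length-filter-cartesianProduct (λ (u , v) → edge? u v) id id

  split : ∀ u v → ⟦ adj? G u v ⟧ ≡ E u v ℕ.+ E v u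
  split u v = ⟦⟧-⊎ (adj? G u v) (edge? u v) (edge? v u)
    cases proj₂ (symm G ∘ proj₂) (λ (u<v , _) (v<u , _) → Fin.<-asym u<v v<u)
    where
    cases : Adj G u v → (u Fin.< v × Adj G u v) ⊎ (v Fin.< u × Adj G v u)
    cases uv with Fin.<-cmp u v
    ... | tri< u<v _ _ = inj₁ (u<v , uv)
    ... | tri≈ _ u≡v _ = contradiction uv (irrefl G u≡v)
    ... | tri> _ _ v<u = inj₂ (v<u , symm G uv)

regular-edges : ∀ {n k} (G : Graph n) → IsRegular G k →
  length (edges G) ℕ.+ length (edges G) ≡ n ℕ.* k
regular-edges {n} {k} G reg =
  trans (sym (handshake G)) (trans (sum-cong-≗ reg) (∑-const n k))

-- Arithmetic of real numbers

-- Lifts identities of rationals, for instance those found by the ring solver, to real numbers term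
-- by term.
≗⇒≈ : ∀ x y → seq x ≗ seq y → x ≈ y
≗⇒≈ x y x≗y ε 0<ε = 0 , λ {n} _ → subst (λ d → ∣ d ∣ ℚ.< ε)
  (sym (trans (cong (ℚ._- seq y n) (x≗y n)) (ℚ.+-inverseʳ (seq y n)))) 0<ε

≈-refl : ∀ {x} → x ≈ x
≈-refl {x} = ≗⇒≈ x x λ _ → refl

≈-sym : ∀ {x y} → x ≈ y → y ≈ x
≈-sym {x} {y} x≈y ε 0<ε = let N , p = x≈y ε 0<ε in
  N , λ {n} N≤n → subst (ℚ._< ε)
    (trans (sym (ℚ.∣-p∣≡∣p∣ (seq x n ℚ.- seq y n)))
           (cong ∣_∣ (sym (neg-swap (seq y n) (seq x n)))))
    (p N≤n)

triangle : ∀ p q r s → ∣ (p ℚ.+ q) ℚ.- (r ℚ.+ s) ∣ ℚ.≤ ∣ p ℚ.- r ∣ ℚ.+ ∣ q ℚ.- s ∣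
triangle p q r s = subst (ℚ._≤ ∣ p ℚ.- r ∣ ℚ.+ ∣ q ℚ.- s ∣)
  (cong ∣_∣ (solve 4 (λ p q r s → (p :- r) :+ (q :- s) := (p :+ q) :- (r :+ s)) refl p q r s))
  (ℚ.∣p+q∣≤∣p∣+∣q∣ (p ℚ.- r) (q ℚ.- s))
  where open ℚ-Solver

+-cong : ∀ x x′ y y′ → x ≈ x′ → y ≈ y′ → x + y ≈ x′ + y′
+-cong x x′ y y′ x≈x′ y≈y′ ε 0<ε =
  let M , p = x≈x′ (½ ℚ.* ε) (half-pos 0<ε)
      N , q = y≈y′ (½ ℚ.* ε) (half-pos 0<ε)
  in M ℕ.⊔ N , λ {n} ≤n → ℚ.≤-<-trans
       (triangle (seq x n) (seq y n) (seq x′ n) (seq y′ n))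
       (subst (∣ seq x n ℚ.- seq x′ n ∣ ℚ.+ ∣ seq y n ℚ.- seq y′ n ∣ ℚ.<_) (halves ε)
         (ℚ.+-mono-< (p (ℕ.m⊔n≤o⇒m≤o M N ≤n)) (q (ℕ.m⊔n≤o⇒n≤o M N ≤n))))

-- Adding the two hypotheses gives `x + y ≈ y + z`, and the difference of the two sides is `x - z`
-- in every term.
≈-trans : ∀ {x y z} → x ≈ y → y ≈ z → x ≈ z
≈-trans {x} {y} {z} x≈y y≈z ε 0<ε =
  let N , p = +-cong x y y z x≈y y≈z ε 0<ε
  in N , λ {n} N≤n → subst (λ d → ∣ d ∣ ℚ.< ε)
       (solve 3 (λ x y z → (x :+ y) :- (y :+ z) := x :- z) refl (seq x n) (seq y n) (seq z n))
       (p N≤n)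
  where open ℚ-Solver

≈-setoid : Setoid _ _
≈-setoid = record
  { Carrier = ℝ
  ; _≈_ = _≈_
  ; isEquivalence = record
    { refl  = λ {x} → ≈-refl {x}
    ; sym   = λ {x} {y} → ≈-sym {x} {y}
    ; trans = λ {x} {y} {z} → ≈-trans {x} {y} {z}
    }
  }

-- Rests on xy - x′y′ = (y - y′)x + (x - x′)y′. With `A` bounding `x` and `D` bounding `y′`, the
-- tolerances `δ` and `η` are chosen so that each summand stays below ε/2.
*-cong : ∀ x x′ y y′ → x ≈ x′ → y ≈ y′ → x * y ≈ x′ * y′
*-cong x x′ y y′ x≈x′ y≈y′ ε 0<ε =
  let A , 0<A , K , ∣x∣≤A  = eventually-bounded x
      D , 0<D , L , ∣y′∣≤D = eventually-bounded y′
      η , 0<η , ηD≡ε/2 = quotient 0<D (half-pos 0<ε)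
      δ , 0<δ , δA≡ε/2 = quotient 0<A (half-pos 0<ε)
      M , p = x≈x′ η 0<η
      N , q = y≈y′ δ 0<δ
  in (K ℕ.⊔ L) ℕ.⊔ (M ℕ.⊔ N) , λ {n} ≤n →
    let KL≤n = ℕ.m⊔n≤o⇒m≤o (K ℕ.⊔ L) (M ℕ.⊔ N) ≤n
        MN≤n = ℕ.m⊔n≤o⇒n≤o (K ℕ.⊔ L) (M ℕ.⊔ N) ≤n
    in subst (∣ seq x n ℚ.* seq y n ℚ.- seq x′ n ℚ.* seq y′ n ∣ ℚ.<_)
      (trans (cong₂ ℚ._+_ δA≡ε/2 ηD≡ε/2) (halves ε))
      (product-close (seq x n) (seq y n) (seq x′ n) (seq y′ n) 0<A 0<D
        (∣x∣≤A (ℕ.m⊔n≤o⇒m≤o K L KL≤n)) (∣y′∣≤D (ℕ.m⊔n≤o⇒n≤o K L KL≤n))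
        (p (ℕ.m⊔n≤o⇒m≤o M N MN≤n)) (q (ℕ.m⊔n≤o⇒n≤o M N MN≤n)))

[x*y]² : ∀ x y → (x * y) ² ≈ x ² * y ²
[x*y]² x y = ≗⇒≈ ((x * y) ²) (x ² * y ²) λ n → interchange (seq x n) (seq y n)
  where
  open ℚ-Solver
  interchange : ∀ p q → (p ℚ.* q) ℚ.* (p ℚ.* q) ≡ (p ℚ.* p) ℚ.* (q ℚ.* q)
  interchange = solve 2 (λ p q → (p :* q) :* (p :* q) := (p :* p) :* (q :* q)) refl

-- A property of the representing sequence, stronger than nonnegativity of the real number.
NonNegative : ℝ → Set
NonNegative x = ∀ n → 0ℚ ℚ.≤ seq x n

fromℕℚ-nonNeg : ∀ n → 0ℚ ℚ.≤ fromℕℚ n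
fromℕℚ-nonNeg n = fromℕℚ-mono-≤ {0} {n} ℕ.z≤n

√-nonNeg : ∀ x → NonNegative (√ x)
√-nonNeg x n = sqrtApprox-nonNeg n (seq x n)

-- Each direction of |√x - r| < ε is an instance of `root-close` with h = ε/2. Nonnegativity of `r`
-- rules out the negative root.
√-unique : ∀ x r → NonNegative r → r ² ≈ x → √ x ≈ r
√-unique x r 0≤r r²≈x ε 0<ε =
  let 0<h = half-pos 0<ε
      0≤h = ℚ.<⇒≤ 0<h
      M , close = r²≈x (½ ℚ.* ε ℚ.* (½ ℚ.* ε)) (*-pos 0<h 0<h)
      N , small = archimedean 0<h
  in M ℕ.⊔ N , λ {n} ≤n →
    let s  = seq (√ x) n
        t  = seq r n
        d  = ∣ t ℚ.* t ℚ.- seq x n ∣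
        d< = close (ℕ.m⊔n≤o⇒m≤o M N ≤n)
        0≤t² = *-nonNeg (0≤r n) (0≤r n)
        t²⊔0≡t² = ℚ.p≥q⇒p⊔q≡p 0≤t²
        t<t+h = subst (ℚ._< t ℚ.+ ½ ℚ.* ε) (ℚ.+-identityʳ t) (ℚ.+-monoʳ-< t 0<h)
        0<t+h = ℚ.≤-<-trans (0≤r n) t<t+h
        -- Here `t` is an exact root of `t * t`, so the slack δ may be `h` itself; it only makes
        -- `t² < (t + h)²` strict.
        above = root-close {q = t ℚ.* t} {d = ∣ seq x n ℚ.- t ℚ.* t ∣}
          0≤h (halves ε) (√-nonNeg x n) (0≤r n) 0≤h
          (sqrtApprox-lower n (seq x n))
          (ℚ.≤-<-trans
            (ℚ.*-monoˡ-≤-nonNeg t {{ℚ.nonNegative (0≤r n)}} (ℚ.<⇒≤ t<t+h))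
            (ℚ.*-monoˡ-<-pos (t ℚ.+ ½ ℚ.* ε) {{ℚ.positive 0<t+h}} t<t+h))
          (subst (λ p → seq x n ℚ.⊔ 0ℚ ℚ.≤ p ℚ.+ ∣ seq x n ℚ.- t ℚ.* t ∣) t²⊔0≡t²
            (⊔0-nonexpansive (seq x n) (t ℚ.* t)))
          (subst (ℚ._< ½ ℚ.* ε ℚ.* (½ ℚ.* ε))
            (trans (cong ∣_∣ (neg-swap (t ℚ.* t) (seq x n))) (ℚ.∣-p∣≡∣p∣ (seq x n ℚ.- t ℚ.* t)))
            d<)
          ℚ.≤-refl
        -- Now the slack is the error 1/(n+1) of `sqrtApprox`, which `small` keeps below or equal to
        -- `h`.
        below = root-close {q = seq x n ℚ.⊔ 0ℚ} {d = d}
          0≤h (halves ε) (0≤r n) (√-nonNeg x n) (1/suc-nonNeg n)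
          ℚ.≤-refl (sqrtApprox-upper n (seq x n))
          (subst (ℚ._≤ seq x n ℚ.⊔ 0ℚ ℚ.+ d) t²⊔0≡t² (⊔0-nonexpansive (t ℚ.* t) (seq x n)))
          d< (small (ℕ.m⊔n≤o⇒n≤o M N ≤n))
    in ∣p∣<q above (subst (ℚ._< ε) (neg-swap t s) below)

-- With r = sqrtApprox n q and z = r + 1/(n+1) one has r² ≤ q < z², so ∣r² - q∣ ≤ ∣r² - z²∣.
√-² : ∀ x → NonNegative x → (√ x) ² ≈ x
√-² x 0≤x ε 0<ε =
  let B , 0<B , K , r≤B = eventually-bounded (√ x)
      -- `C` bounds `z`, since `≤1` makes the increment 1/(n+1) at most 1.
      C = B ℚ.+ 1ℚ
      0<1 = ℚ.positive⁻¹ 1ℚ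
      0<C = ℚ.+-mono-< 0<B 0<1
      η , 0<η , η[B+C]≡ε = quotient (ℚ.+-mono-< 0<B 0<C) 0<ε
      -- `archimedean` gives only a weak inequality; aiming at η/2 yields 1/(n+1) < η.
      L , small = archimedean (half-pos 0<η)
      N , ≤1 = archimedean 0<1
  in K ℕ.⊔ (L ℕ.⊔ N) , λ {n} ≤n →
    let q = seq x n
        r = seq (√ x) n
        δ = 1/suc n
        z = r ℚ.+ δ
        K≤n = ℕ.m⊔n≤o⇒m≤o K (L ℕ.⊔ N) ≤n
        LN≤n = ℕ.m⊔n≤o⇒n≤o K (L ℕ.⊔ N) ≤n
        δ<η = ℚ.≤-<-trans (small (ℕ.m⊔n≤o⇒m≤o L N LN≤n)) (half-< 0<η)
        r²≤q = subst (r ℚ.* r ℚ.≤_) (ℚ.p≥q⇒p⊔q≡p (0≤x n)) (sqrtApprox-lower n q)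
        q≤z² = subst (ℚ._≤ z ℚ.* z) (ℚ.p≥q⇒p⊔q≡p (0≤x n)) (ℚ.<⇒≤ (sqrtApprox-upper n q))
        ∣r-z∣<η = subst (ℚ._< η) (sym (trans (cong ∣_∣ (cancel r δ))
                    (trans (ℚ.∣-p∣≡∣p∣ δ) (ℚ.0≤p⇒∣p∣≡p (1/suc-nonNeg n))))) δ<η
        ∣z∣≤C = ℚ.≤-trans (ℚ.∣p+q∣≤∣p∣+∣q∣ r δ) (ℚ.+-mono-≤ (r≤B K≤n)
                  (subst (ℚ._≤ 1ℚ) (sym (ℚ.0≤p⇒∣p∣≡p (1/suc-nonNeg n)))
                    (≤1 (ℕ.m⊔n≤o⇒n≤o L N LN≤n))))
    in ℚ.≤-<-trans (squeeze r²≤q q≤z²)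
         (subst (∣ r ℚ.* r ℚ.- z ℚ.* z ∣ ℚ.<_)
           (trans (sym (ℚ.*-distribˡ-+ η B C)) η[B+C]≡ε)
           (product-close r r z z 0<B 0<C (r≤B K≤n) ∣z∣≤C ∣r-z∣<η ∣r-z∣<η))
  where
  1/suc : ℕ → ℚ
  1/suc n = + 1 ℚ./ suc n

  half-< : ∀ {η} → 0ℚ ℚ.< η → ½ ℚ.* η ℚ.< η
  half-< {η} 0<η = subst₂ ℚ._<_ (ℚ.+-identityʳ (½ ℚ.* η)) (halves η)
    (ℚ.+-monoʳ-< (½ ℚ.* η) (half-pos 0<η))

  cancel : ∀ r δ → r ℚ.- (r ℚ.+ δ) ≡ ℚ.- δ
  cancel = solve 2 (λ r δ → r :- (r :+ δ) := :- δ) refl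
    where open ℚ-Solver

  distance : ∀ {p q} → p ℚ.≤ q → ∣ p ℚ.- q ∣ ≡ q ℚ.- p
  distance {p} {q} p≤q = begin
    ∣ p ℚ.- q ∣       ≡⟨ cong ∣_∣ (neg-swap p q) ⟩
    ∣ ℚ.- (q ℚ.- p) ∣ ≡⟨ ℚ.∣-p∣≡∣p∣ (q ℚ.- p) ⟩
    ∣ q ℚ.- p ∣       ≡⟨ ℚ.0≤p⇒∣p∣≡p (subst (ℚ._≤ q ℚ.- p) (ℚ.+-inverseʳ p) (ℚ.+-monoˡ-≤ (ℚ.- p) p≤q)) ⟩
    q ℚ.- p           ∎
    where open ≡-Reasoning

  squeeze : ∀ {a b c} → a ℚ.≤ b → b ℚ.≤ c → ∣ a ℚ.- b ∣ ℚ.≤ ∣ a ℚ.- c ∣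
  squeeze {a} a≤b b≤c = subst₂ ℚ._≤_ (sym (distance a≤b)) (sym (distance (ℚ.≤-trans a≤b b≤c)))
    (ℚ.+-monoˡ-≤ (ℚ.- a) b≤c)

-- The Sombor index of a regular graph

-- Regularity makes all summands of `SO` the same real number, so the sum can be evaluated exactly
-- in each term of the sequence.
sum-map-const : ∀ {a} {A : Set a} (f : A → ℝ) c → (∀ x → f x ≡ c) → ∀ xs n →
  seq (sumℝ (map f xs)) n ≡ fromℕℚ (length xs) ℚ.* seq c n
sum-map-const f c f≡c []       n = sym (ℚ.*-zeroˡ (seq c n))
sum-map-const f c f≡c (x ∷ xs) n = begin
  seq (f x) n ℚ.+ seq (sumℝ (map f xs)) n
    ≡⟨ cong₂ ℚ._+_ (cong (λ y → seq y n) (f≡c x)) (sum-map-const f c f≡c xs n) ⟩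
  seq c n ℚ.+ fromℕℚ (length xs) ℚ.* seq c n
    ≡⟨ cong (ℚ._+ fromℕℚ (length xs) ℚ.* seq c n) (ℚ.*-identityˡ (seq c n)) ⟨
  1ℚ ℚ.* seq c n ℚ.+ fromℕℚ (length xs) ℚ.* seq c n
    ≡⟨ ℚ.*-distribʳ-+ (seq c n) 1ℚ (fromℕℚ (length xs)) ⟨
  (1ℚ ℚ.+ fromℕℚ (length xs)) ℚ.* seq c n
    ≡⟨ cong (ℚ._* seq c n) (fromℕℚ-+ 1 (length xs)) ⟨
  fromℕℚ (suc (length xs)) ℚ.* seq c n ∎
  where open ≡-Reasoning

√2 : ℝ
√2 = √ (fromℕ 2)

-- By `√-unique`: k√2 is nonnegative and its square is 2k².
√[k²+k²] : ∀ k → √ (fromℕ k ² + fromℕ k ²) ≈ fromℕ k * √2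
√[k²+k²] k = √-unique (fromℕ k ² + fromℕ k ²) (fromℕ k * √2)
  (λ n → *-nonNeg (fromℕℚ-nonNeg k) (√-nonNeg (fromℕ 2) n)) (begin
    (fromℕ k * √2) ²
      ≈⟨ [x*y]² (fromℕ k) √2 ⟩
    fromℕ k ² * √2 ²
      ≈⟨ *-cong (fromℕ k ²) (fromℕ k ²) (√2 ²) (fromℕ 2)
           (≈-refl {fromℕ k ²}) (√-² (fromℕ 2) (λ _ → fromℕℚ-nonNeg 2)) ⟩
    fromℕ k ² * fromℕ 2
      ≈⟨ ≗⇒≈ (fromℕ k ² * fromℕ 2) (fromℕ k ² + fromℕ k ²)
           (λ _ → double (fromℕℚ k ℚ.* fromℕℚ k)) ⟩
    fromℕ k ² + fromℕ k ² ∎)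
  where
  open SetoidReasoning ≈-setoid
  double : ∀ p → p ℚ.* fromℕℚ 2 ≡ p ℚ.+ p
  -- `fromℕℚ 2` computes to `1ℚ ℚ.+ 1ℚ`, so distributivity applies directly.
  double p = trans (ℚ.*-distribˡ-+ p 1ℚ 1ℚ) (cong₂ ℚ._+_ (ℚ.*-identityʳ p) (ℚ.*-identityʳ p))

τ² : ℕ → ℝ
τ² n = (fromℚ ½ * fromℕ n) * √2

τ : ℕ → ℝ
τ n = √ τ² n

τ²-nonNeg : ∀ n → NonNegative (τ² n)
τ²-nonNeg n i = *-nonNeg (*-nonNeg (ℚ.nonNegative⁻¹ ½) (fromℕℚ-nonNeg n)) (√-nonNeg (fromℕ 2) i)

-- One factor k joins n/2 to give the number of edges, the other joins √2 to give the weight of an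
-- edge. The square stands on the left, as `√-unique` requires.
SO-regular : ∀ {n k} (G : Graph n) → IsRegular G k → (fromℕ k * τ n) ² ≈ SO G
SO-regular {n} {k} G reg = begin
  (fromℕ k * τ n) ²
    ≈⟨ [x*y]² (fromℕ k) (τ n) ⟩
  fromℕ k ² * τ n ²
    ≈⟨ *-cong (fromℕ k ²) (fromℕ k ²) (τ n ²) (τ² n)
         (≈-refl {fromℕ k ²}) (√-² (τ² n) (τ²-nonNeg n)) ⟩
  fromℕ k ² * τ² n
    ≈⟨ ≗⇒≈ (fromℕ k ² * τ² n) ((fromℚ ½ * (fromℕ n * fromℕ k)) * (fromℕ k * √2))
         (λ i → regroup ½ (fromℕℚ n) (fromℕℚ k) (seq √2 i)) ⟩
  (fromℚ ½ * (fromℕ n * fromℕ k)) * (fromℕ k * √2)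
    ≈⟨ *-cong (fromℚ ½ * (fromℕ n * fromℕ k)) (fromℕ m) (fromℕ k * √2) (fromℕ k * √2)
         (≗⇒≈ (fromℚ ½ * (fromℕ n * fromℕ k)) (fromℕ m) (λ _ → ½nk≡m))
         (≈-refl {fromℕ k * √2}) ⟩
  fromℕ m * (fromℕ k * √2)
    ≈⟨ *-cong (fromℕ m) (fromℕ m) (√ (fromℕ k ² + fromℕ k ²)) (fromℕ k * √2)
         (≈-refl {fromℕ m}) (√[k²+k²] k) ⟨
  fromℕ m * √ (fromℕ k ² + fromℕ k ²)
    ≈⟨ ≗⇒≈ (SO G) (fromℕ m * √ (fromℕ k ² + fromℕ k ²))
         (sum-map-const (λ (u , v) → √ (fromℕ (degree G u) ² + fromℕ (degree G v) ²))
           (√ (fromℕ k ² + fromℕ k ²))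
           (λ (u , v) → cong₂ (λ a b → √ (fromℕ a ² + fromℕ b ²))
             {degree G u} {k} {degree G v} {k} (reg u) (reg v)) (edges G)) ⟨
  SO G ∎
  where
  open SetoidReasoning ≈-setoid
  m : ℕ
  m = length (edges G)

  regroup : ∀ h p q r → (q ℚ.* q) ℚ.* ((h ℚ.* p) ℚ.* r) ≡ (h ℚ.* (p ℚ.* q)) ℚ.* (q ℚ.* r)
  regroup = solve 4
    (λ h p q r → (q :* q) :* ((h :* p) :* r) := (h :* (p :* q)) :* (q :* r)) refl
    where open ℚ-Solver

  ½nk≡m : ½ ℚ.* (fromℕℚ n ℚ.* fromℕℚ k) ≡ fromℕℚ m
  -- Half of the identity m + m = nk from `regular-edges`.
  ½nk≡m = trans
    (cong (½ ℚ.*_) (trans (sym (fromℕℚ-* n k))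
      (trans (cong fromℕℚ (sym (regular-edges G reg))) (fromℕℚ-+ m m))))
    (trans (ℚ.*-distribˡ-+ ½ (fromℕℚ m) (fromℕℚ m)) (halves (fromℕℚ m)))

√SO-regular : ∀ {n k} (G : Graph n) → IsRegular G k → √ SO G ≈ fromℕ k * τ n
√SO-regular {n} {k} G reg = √-unique (SO G) (fromℕ k * τ n)
  (λ i → *-nonNeg (fromℕℚ-nonNeg k) (√-nonNeg (τ² n) i)) (SO-regular G reg)

-- A regular graph together with its complement

-- Both sides are ((a + b)τ)², by distributivity. Writing the degree of the complete graph as
-- `a + b` avoids the truncated subtraction n - 1 - k and lets the case n = 0 fit in.
SO-regular-complement : ∀ {n a b} (G : Graph n) →
  IsRegular G a → IsRegular (complement G) b → IsRegular (complete n) (a ℕ.+ b) →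
  SO (complete n) ≈ (√ SO G + √ SO (complement G)) ²
SO-regular-complement {n} {a} {b} G regG regḠ regK = begin
  SO (complete n)
    ≈⟨ SO-regular (complete n) regK ⟨
  (fromℕ (a ℕ.+ b) * τ n) ²
    ≈⟨ ≗⇒≈ ((fromℕ (a ℕ.+ b) * τ n) ²) (kτ ²) (λ i → cong (λ p → p ℚ.* p)
         (trans (cong (ℚ._* seq (τ n) i) (fromℕℚ-+ a b))
           (ℚ.*-distribʳ-+ (seq (τ n) i) (fromℕℚ a) (fromℕℚ b)))) ⟩
  kτ ²
    ≈⟨ *-cong root kτ root kτ root≈ root≈ ⟨
  root ² ∎
  where
  open SetoidReasoning ≈-setoid
  root kτ : ℝ
  root = √ SO G + √ SO (complement G)
  kτ = fromℕ a * τ n + fromℕ b * τ n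

  root≈ : root ≈ kτ
  root≈ = +-cong (√ SO G) (fromℕ a * τ n) (√ SO (complement G)) (fromℕ b * τ n)
    (√SO-regular G regG) (√SO-regular (complement G) regḠ)

theorem6p1 : (n k : ℕ) (G : Graph n) → IsRegular G k →
    SO (complete n) ≈ (√ SO G + √ SO (complement G)) ²
-- On the empty vertex set a graph is regular of every degree, so 0 can stand for all three.
theorem6p1 zero    k G reg = SO-regular-complement {a = 0} {b = 0} G (λ ()) (λ ()) (λ ())
-- The degree of the complement is read off at the vertex `zero`. By `total`, adding k to the
-- complement degree of any vertex gives n, so cancelling k shows that all these degrees agree.
theorem6p1 (suc n) k G reg = SO-regular-complement {b = degree (complement G) zero} G reg
  (λ u → ℕ.+-cancelˡ-≡ k _ _ (trans (sym (total u)) (trans (degree-complete n u)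
    (trans (sym (degree-complete n zero)) (total zero)))))
  (λ u → trans (degree-complete n u) (trans (sym (degree-complete n zero)) (total zero)))
  where
  total : ∀ u → degree (complete (suc n)) u ≡ k ℕ.+ degree (complement G) u
  total u = trans (degree-complement G u) (cong (ℕ._+ degree (complement G) u) (reg u))
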